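{- Let $\gamma\ge 1$. Let $g(R)=\sum_{q\in R}g(q)$, $R\subseteq[n]$, be a non-negative modular function (i.e. $g(q)\ge 0$ for all $q\in[n]$), and let $d(R)=\sum_{\{q,q'\}\subseteq R}A(q,q')$ (sum over unordered pairs of distinct elements of $R$) be a diversity function, where $A$ is a $\gamma$-semi-metric distance on $[n]$. Then $f(R):=d(R)+g(R)$ is a $\gamma$-meta-submodular function on $2^{[n]}$.
   Context: $[n]=\{1,\dots,n\}$; $S+i=S\cup\{i\}$, $S-i=S\setminus\{i\}$ (operations applied from left to right). A $\gamma$-semi-metric distance $A$ on $[n]$ is a symmetric, zero-diagonal matrix with non-negative entries such that $A(i,j)\le\gamma(A(i,k)+A(k,j))$ for all $i,j,k\in[n]$. For a set function $f$ on $2^{[n]}$, define $B_i(S)=f(S+i)-f(S-i)$ and $A_{ij}(S)=B_j(S+i)-B_j(S-i)=f(S+i+j)-f(S+i-j)-f(S-i+j)+f(S-i-j)$ (so $A_{ii}(S)=0$). For $\gamma\ge 0$, $f$ is $\gamma$-meta-submodular if for every nonempty $S\subseteq[n]$ and all $i,j\in[n]$, $A_{ij}(S)\le\gamma\,\frac{B_i(S)+B_j(S)}{|S|}$. -}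

module Defs where

open import Level using (_⊔_) renaming (suc to lsuc)
open import Algebra.Apartness.Bundles using (HeytingCommutativeRing; HeytingField)
open import Algebra.Bundles using (CommutativeRing)
open import Data.Bool.Base using (if_then_else_)
open import Data.Fin.Base using (Fin)
open import Data.Fin.Properties using (_<?_)
open import Data.Fin.Subset using (Subset; Nonempty; _∈_; ∣_∣; ⁅_⁆; _∪_; _-_)
open import Data.Fin.Subset.Properties using (∣⁅x⁆∣≡1; p⊆q⇒∣p∣≤∣q∣; x∈⁅y⁆⇒x≡y)
open import Data.Nat.Base using (ℕ; zero; suc; NonZero; >-nonZero)
import Data.Nat.Base as ℕ
open import Data.Product.Base using (_,_; proj₁)
open import Data.Sum.Base using (_⊎_; inj₁; inj₂)
open import Data.Vec.Base using (lookup)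
open import Relation.Binary.Core using (Rel)
open import Relation.Binary.PropositionalEquality.Core using (subst)
import Relation.Binary.PropositionalEquality.Core as ≡
open import Relation.Binary.Structures using (IsStrictPartialOrder)
open import Relation.Nullary.Decidable.Core using (does)
open import Relation.Nullary.Negation.Core using (¬_; contradiction)

import Algebra.Apartness.Properties.HeytingCommutativeRing as HeytingProperties
import Algebra.Properties.CommutativeMonoid.Sum as Sum
import Algebra.Properties.Monoid.Mult as Mult
import Algebra.Properties.Ring as RingProperties

-- Real scalars are replaced by an arbitrary ordered field. The strict order is
-- primitive, and apartness means strictly smaller or strictly greater: when _#_
-- is the negation of _≈_ and both are decidable, this is the usual notion of a
-- totally ordered field; the constructive reals also satisfy it.
record OrderedField c ℓ₁ ℓ₂ ℓ₃ : Set (lsuc (c ⊔ ℓ₁ ⊔ ℓ₂ ⊔ ℓ₃)) where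
  field
    heytingField : HeytingField c ℓ₁ ℓ₂

  open HeytingField heytingField public

  infix 4 _<_ _≤_

  field
    _<_                  : Rel Carrier ℓ₃
    isStrictPartialOrder : IsStrictPartialOrder _≈_ _<_
    #⇒<⊎>                : ∀ {x y} → x # y → x < y ⊎ y < x
    <⇒#                  : ∀ {x y} → x < y → x # y
    +-monoˡ-<            : ∀ z {x y} → x < y → x + z < y + z
    *-pos                : ∀ {x y} → 0# < x → 0# < y → 0# < x * y

  open IsStrictPartialOrder isStrictPartialOrder public
    using (<-resp-≈; <-respˡ-≈; <-respʳ-≈)
    renaming (irrefl to <-irrefl; trans to <-trans)

  _≤_ : Rel Carrier ℓ₃
  x ≤ y = ¬ (y < x)

  commutativeRing : CommutativeRing c ℓ₁
  commutativeRing = HeytingCommutativeRing.commutativeRing heytingCommutativeRing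

  open CommutativeRing commutativeRing public
    using (ring; +-monoid; +-commutativeMonoid)

  open Mult +-monoid public using (_×_)

  0<1 : 0# < 1#
  0<1 with #⇒<⊎> (HeytingProperties.1#0 heytingCommutativeRing)
  ... | inj₂ 0<1′ = 0<1′
  ... | inj₁ 1<0  = contradiction (<-trans 1<0 0<1′) (<-irrefl refl)
    where
    open RingProperties ring using (-1*x≈-x; -‿involutive)

    0<-1 : 0# < - 1#
    0<-1 = <-respˡ-≈ (-‿inverseʳ 1#) (<-respʳ-≈ (+-identityˡ (- 1#)) (+-monoˡ-< (- 1#) 1<0))

    0<1′ : 0# < 1#
    0<1′ = <-respʳ-≈ (trans (-1*x≈-x (- 1#)) (-‿involutive 1#)) (*-pos 0<-1 0<-1)

  0<1+k : ∀ k → 0# < suc k × 1#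
  0<1+k zero    = <-respʳ-≈ (sym (+-identityʳ 1#)) 0<1
  0<1+k (suc k) = <-trans (0<1+k k)
    (<-respˡ-≈ (+-identityˡ (suc k × 1#)) (+-monoˡ-< (suc k × 1#) 0<1))

  infixl 7 _/_

  _/_ : Carrier → (k : ℕ) → .{{NonZero k}} → Carrier
  x / suc k = x * proj₁ (#⇒invertible (#-sym (<⇒# (0<1+k k))))

nonempty⇒nonZero : ∀ {n} {S : Subset n} → Nonempty S → NonZero ∣ S ∣
nonempty⇒nonZero {S = S} (x , x∈S) = >-nonZero
  (subst (ℕ._≤ ∣ S ∣) (∣⁅x⁆∣≡1 x)
    (p⊆q⇒∣p∣≤∣q∣ λ y∈⁅x⁆ → subst (λ z → z ∈ S) (≡.sym (x∈⁅y⁆⇒x≡y x y∈⁅x⁆)) x∈S))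

module SetFunctions {c ℓ₁ ℓ₂ ℓ₃} (F : OrderedField c ℓ₁ ℓ₂ ℓ₃) where

  open OrderedField F renaming (_-_ to infixl 6 _−_)
  open Sum +-commutativeMonoid using (sum-syntax)

  SetFunction : ℕ → Set c
  SetFunction n = Subset n → Carrier

  -- The ground set [n] is Fin n.
  Matrix : ℕ → Set c
  Matrix n = Fin n → Fin n → Carrier

  record IsSemiMetric {n} (γ : Carrier) (A : Matrix n) : Set (ℓ₁ ⊔ ℓ₃) where
    field
      symmetric    : ∀ i j → A i j ≈ A j i
      zeroDiagonal : ∀ i → A i i ≈ 0#
      nonNegative  : ∀ i j → 0# ≤ A i j
      triangle     : ∀ i j k → A i j ≤ γ * (A i k + A k j)

  sumOver : ∀ {n} → Subset n → (Fin n → Carrier) → Carrier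
  sumOver {n} R w = ∑[ q < n ] (if lookup R q then w q else 0#)

  modular : ∀ {n} → (Fin n → Carrier) → SetFunction n
  modular g R = sumOver R g

  -- Each unordered pair {q , q′} is counted once, through its ordering q < q′.
  diversity : ∀ {n} → Matrix n → SetFunction n
  diversity A R = sumOver R λ q → sumOver R λ q′ → if does (q <? q′) then A q q′ else 0#

  infixl 6 _⊹_

  _⊹_ : ∀ {n} → Subset n → Fin n → Subset n
  S ⊹ i = S ∪ ⁅ i ⁆

  B : ∀ {n} → SetFunction n → Fin n → Subset n → Carrier
  B f i S = f (S ⊹ i) − f (S - i)

  secondDifference : ∀ {n} → SetFunction n → Fin n → Fin n → Subset n → Carrier
  secondDifference f i j S = B f j (S ⊹ i) − B f j (S - i)

  MetaSubmodular : ∀ {n} → Carrier → SetFunction n → Set ℓ₃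
  MetaSubmodular γ f = ∀ S (S≢∅ : Nonempty S) i j →
    secondDifference f i j S ≤ γ * (_/_ (B f i S + B f j S) ∣ S ∣ {{nonempty⇒nonZero S≢∅}})

{-# OPTIONS --safe #-}
-- Discrete derivatives of f are explicit: B_i(S) = Σ_{q ∈ S} A(i,q) + g(i) and A_ij(S) = A(i,j).
-- Summing the relaxed triangle inequality A(i,j) ≤ γ (A(i,q) + A(q,j)) over q ∈ S gives
-- |S| A(i,j) ≤ γ Σ_{q ∈ S} (A(i,q) + A(j,q)) ≤ γ (B_i(S) + B_j(S)).
module Submission where

open import Defs
open import Algebra.Bundles using (CommutativeRing)
open import Data.Bool.Base using (true; false; if_then_else_; _∨_)
open import Data.Fin.Base using (Fin; zero; suc)
open import Data.Fin.Properties using (_<?_; <-cmp) renaming (<-irrefl to <ꟳ-irrefl)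
open import Data.Fin.Subset using (Subset; inside; outside; ⊥; ∣_∣; _─_; _-_)
open import Data.Fin.Subset.Properties using (∪-identityʳ; p─⊥≡p)
open import Data.Nat.Base using (ℕ; suc; NonZero)
open import Data.Product.Base using (_,_)
open import Data.Sum.Base using (inj₁; inj₂)
open import Data.Vec.Base using ([]; _∷_; lookup)
open import Function.Base using (_∘_)
open import Relation.Binary.Definitions using (tri<; tri≈; tri>)
open import Relation.Binary.PropositionalEquality.Core using (cong)
import Relation.Binary.PropositionalEquality.Core as ≡
open import Relation.Nullary.Decidable.Core using (does)
open import Relation.Nullary.Decidable using (dec-true; dec-false)
open import Relation.Nullary.Negation.Core using (contradiction)

import Algebra.Apartness.Properties.HeytingCommutativeRing as HeytingProperties
import Algebra.Properties.AbelianGroup as AbelianGroupProperties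
import Algebra.Properties.CommutativeMonoid.Sum as Sum
import Algebra.Properties.CommutativeSemigroup as CommutativeSemigroupProperties
import Algebra.Properties.Semiring.Mult as SemiringMult
import Algebra.Properties.Semiring.Sum as SemiringSum
import Relation.Binary.Reasoning.Setoid as ≈-Reasoning

-- Arithmetic and order in an ordered field.

module OrderedFieldProperties {c ℓ₁ ℓ₂ ℓ₃} (F : OrderedField c ℓ₁ ℓ₂ ℓ₃) where

  open OrderedField F renaming (_-_ to infixl 6 _−_)
  open CommutativeRing commutativeRing using (semiring; +-abelianGroup)
  open HeytingProperties heytingCommutativeRing using (x-0≈x; invertibleʳ⇒#)
  open AbelianGroupProperties +-abelianGroup using (xyx⁻¹≈y; //-rightDividesˡ)
  open SemiringMult semiring using (×-comm-*; ×-congʳ)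
  open ≈-Reasoning setoid

  x≈y+z⇒x−y≈z : ∀ {x y z} → x ≈ y + z → x − y ≈ z
  x≈y+z⇒x−y≈z {x} {y} {z} x≈y+z = trans (+-congʳ x≈y+z) (xyx⁻¹≈y y z)

  n×[x/n]≈x : ∀ n .{{_ : NonZero n}} x → n × (x / n) ≈ x
  -- This is the very inverse chosen inside `_/_`, so the quotient reduces to `x * n⁻¹`.
  -- Invertibility concerns the difference `suc k × 1# − 0#`, hence the use of `x-0≈x`.
  n×[x/n]≈x (suc k) x with #⇒invertible (#-sym (<⇒# (0<1+k k)))
  ... | n⁻¹ , n⁻¹*n≈1 , _ = begin
    suc k × (x * n⁻¹)              ≈⟨ ×-congʳ (suc k) (*-identityʳ _) ⟨
    suc k × (x * n⁻¹ * 1#)         ≈⟨ ×-comm-* (suc k) (x * n⁻¹) 1# ⟨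
    x * n⁻¹ * (suc k × 1#)         ≈⟨ *-assoc x n⁻¹ _ ⟩
    x * (n⁻¹ * (suc k × 1#))       ≈⟨ *-congˡ (*-congˡ (x-0≈x _)) ⟨
    x * (n⁻¹ * (suc k × 1# − 0#))  ≈⟨ *-congˡ n⁻¹*n≈1 ⟩
    x * 1#                         ≈⟨ *-identityʳ x ⟩
    x                              ∎

  -- If `z` inverts `x * y`, then `y * z` inverts `x`, and invertible elements are apart from zero.
  x*y#0⇒x#0 : ∀ {x y} → x * y # 0# → x # 0#
  x*y#0⇒x#0 {x} {y} xy#0 with #⇒invertible xy#0
  ... | z , _ , xy*z≈1 = invertibleʳ⇒# (y * z , (begin
    (x − 0#) * (y * z)  ≈⟨ *-congʳ (x-0≈x x) ⟩
    x * (y * z)         ≈⟨ *-assoc x y z ⟨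
    x * y * z           ≈⟨ *-congʳ (x-0≈x (x * y)) ⟨
    (x * y − 0#) * z    ≈⟨ xy*z≈1 ⟩
    1#                  ∎))

  -- Cotransitivity of apartness locates `z` relative to `x` or to `y`. Each apartness splits into
  -- two strict inequalities, and every case with `z` on the wrong side yields `z < y`, which
  -- `y ≤ z` denies.
  <-≤-trans : ∀ {x y z} → x < y → y ≤ z → x < z
  <-≤-trans {z = z} x<y y≤z with #-cotrans (<⇒# x<y) z
  ... | inj₂ z#y with #⇒<⊎> z#y
  ...   | inj₁ z<y = contradiction z<y y≤z
  ...   | inj₂ y<z = <-trans x<y y<z
  <-≤-trans {z = z} x<y y≤z | inj₁ x#z with #⇒<⊎> x#z
  ...   | inj₁ x<z = x<z
  ...   | inj₂ z<x = contradiction (<-trans z<x x<y) y≤z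

  ≤-trans : ∀ {x y z} → x ≤ y → y ≤ z → x ≤ z
  ≤-trans x≤y y≤z z<x = y≤z (<-≤-trans z<x x≤y)

  <⇒≤ : ∀ {x y} → x < y → x ≤ y
  <⇒≤ x<y y<x = <-irrefl refl (<-trans x<y y<x)

  ≤-refl : ∀ {x} → x ≤ x
  ≤-refl = <-irrefl refl

  ≤-respˡ-≈ : ∀ {x y z} → y ≈ z → y ≤ x → z ≤ x
  ≤-respˡ-≈ y≈z y≤x x<z = y≤x (<-respʳ-≈ (sym y≈z) x<z)

  ≤-respʳ-≈ : ∀ {x y z} → y ≈ z → x ≤ y → x ≤ z
  ≤-respʳ-≈ y≈z x≤y z<x = x≤y (<-respˡ-≈ (sym y≈z) z<x)

  +-monoˡ-≤ : ∀ z {x y} → x ≤ y → x + z ≤ y + z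
  +-monoˡ-≤ z {x} {y} x≤y y+z<x+z =
    x≤y (<-respˡ-≈ (cancel y) (<-respʳ-≈ (cancel x) (+-monoˡ-< (- z) y+z<x+z)))
    where
    cancel : ∀ w → w + z − z ≈ w
    cancel w = trans (+-assoc w z (- z)) (trans (+-congˡ (-‿inverseʳ z)) (+-identityʳ w))

  +-monoʳ-≤ : ∀ z {x y} → x ≤ y → z + x ≤ z + y
  +-monoʳ-≤ z x≤y = ≤-respˡ-≈ (+-comm _ z) (≤-respʳ-≈ (+-comm _ z) (+-monoˡ-≤ z x≤y))

  +-mono-≤ : ∀ {w x y z} → w ≤ x → y ≤ z → w + y ≤ x + z
  +-mono-≤ {x = x} {y} w≤x y≤z = ≤-trans (+-monoˡ-≤ y w≤x) (+-monoʳ-≤ x y≤z)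

  +-mono-< : ∀ {w x y z} → w < x → y < z → w + y < x + z
  +-mono-< {x = x} {y} w<x y<z =
    <-trans (+-monoˡ-< y w<x) (<-respˡ-≈ (+-comm y x) (<-respʳ-≈ (+-comm _ x) (+-monoˡ-< x y<z)))

  ×-monoʳ-< : ∀ n .{{_ : NonZero n}} {x y} → x < y → n × x < n × y
  -- The induction starts at one, since strictness fails at zero; `1 × x` unfolds to `x + 0#`.
  ×-monoʳ-< (suc 0)       x<y = +-monoˡ-< 0# x<y
  ×-monoʳ-< (suc (suc n)) x<y = +-mono-< x<y (×-monoʳ-< (suc n) x<y)

  ×-cancelˡ-≤ : ∀ n .{{_ : NonZero n}} {x y} → n × x ≤ n × y → x ≤ y
  ×-cancelˡ-≤ n nx≤ny y<x = nx≤ny (×-monoʳ-< n y<x)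

  -- A negative product is apart from zero, so both factors are. Being non-negative, they are then
  -- positive, and so is their product: a contradiction.
  nonNeg*nonNeg : ∀ {x y} → 0# ≤ x → 0# ≤ y → 0# ≤ x * y
  nonNeg*nonNeg {x} {y} 0≤x 0≤y xy<0
    with #⇒<⊎> (x*y#0⇒x#0 (<⇒# xy<0)) | #⇒<⊎> (x*y#0⇒x#0 (<⇒# (<-respˡ-≈ (*-comm x y) xy<0)))
  ... | inj₁ x<0 | _        = 0≤x x<0
  ... | inj₂ _   | inj₁ y<0 = 0≤y y<0
  ... | inj₂ 0<x | inj₂ 0<y = <⇒≤ (*-pos 0<x 0<y) xy<0

  x≤x+nonNeg : ∀ {x y} → 0# ≤ y → x ≤ x + y
  x≤x+nonNeg {x} 0≤y = ≤-respˡ-≈ (+-identityʳ x) (+-monoʳ-≤ x 0≤y)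

  *-monoˡ-≤-nonNeg : ∀ {x y z} → 0# ≤ x → y ≤ z → x * y ≤ x * z
  *-monoˡ-≤-nonNeg {x} {y} {z} 0≤x y≤z = ≤-respʳ-≈ eq (x≤x+nonNeg (nonNeg*nonNeg 0≤x 0≤z−y))
    where
    0≤z−y : 0# ≤ z − y
    0≤z−y = ≤-respˡ-≈ (-‿inverseʳ y) (+-monoˡ-≤ (- y) y≤z)

    eq : x * y + x * (z − y) ≈ x * z
    eq = trans (sym (distribˡ x y (z − y)))
      (*-congˡ (trans (+-comm y (z − y)) (//-rightDividesˡ y z)))

-- Sums over subsets.

module SetFunctionProperties {c ℓ₁ ℓ₂ ℓ₃} (F : OrderedField c ℓ₁ ℓ₂ ℓ₃) where

  open OrderedField F hiding (zero) renaming (_-_ to infixl 6 _−_)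
  open SetFunctions F
  open OrderedFieldProperties F
  open CommutativeRing commutativeRing using (semiring; +-commutativeSemigroup)
  open CommutativeSemigroupProperties +-commutativeSemigroup using (interchange; xy∙z≈xz∙y)
  open SemiringMult semiring using (×-comm-*)
  open Sum +-commutativeMonoid using (sum-cong-≋; ∑-distrib-+)
  open SemiringSum semiring using (*-distribˡ-sum)
  open ≈-Reasoning setoid

  private variable
    n : ℕ

  restrict : Subset n → (Fin n → Carrier) → Fin n → Carrier
  restrict R w q = if lookup R q then w q else 0#

  sumOver-cong : ∀ (R : Subset n) {v w} → (∀ q → v q ≈ w q) → sumOver R v ≈ sumOver R w
  sumOver-cong R {v} {w} v≈w = sum-cong-≋ λ q → go (lookup R q) (v≈w q)
    where
    go : ∀ b {x y} → x ≈ y → (if b then x else 0#) ≈ (if b then y else 0#)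
    go true  x≈y = x≈y
    go false _   = refl

  sumOver-+ : ∀ (R : Subset n) v w → sumOver R (λ q → v q + w q) ≈ sumOver R v + sumOver R w
  sumOver-+ R v w = trans (sum-cong-≋ λ q → go (lookup R q)) (∑-distrib-+ (restrict R v) (restrict R w))
    where
    go : ∀ b {x y} → (if b then x + y else 0#) ≈ (if b then x else 0#) + (if b then y else 0#)
    go true  = refl
    go false = sym (+-identityʳ 0#)

  sumOver-* : ∀ (R : Subset n) x w → sumOver R (λ q → x * w q) ≈ x * sumOver R w
  sumOver-* R x w = trans (sum-cong-≋ λ q → go (lookup R q)) (sym (*-distribˡ-sum x (restrict R w)))
    where
    go : ∀ b {y} → (if b then x * y else 0#) ≈ x * (if b then y else 0#)
    go true  = refl
    go false = sym (zeroʳ x)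

  sumOver-const : ∀ (R : Subset n) x → sumOver R (λ _ → x) ≈ ∣ R ∣ × x
  sumOver-const []            x = refl
  sumOver-const (inside  ∷ R) x = +-congˡ (sumOver-const R x)
  sumOver-const (outside ∷ R) x = trans (+-identityˡ _) (sumOver-const R x)

  sumOver-mono : ∀ (R : Subset n) {v w} → (∀ q → v q ≤ w q) → sumOver R v ≤ sumOver R w
  sumOver-mono []            v≤w = ≤-refl
  sumOver-mono (inside  ∷ R) v≤w = +-mono-≤ (v≤w zero) (sumOver-mono R (v≤w ∘ suc))
  sumOver-mono (outside ∷ R) v≤w = +-mono-≤ ≤-refl (sumOver-mono R (v≤w ∘ suc))

  sumOver-─⊥ : ∀ (R : Subset n) w → sumOver (R ─ ⊥) w ≈ sumOver R w
  sumOver-─⊥ R w = reflexive (cong (λ T → sumOver T w) (p─⊥≡p R))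

  -- Comparing with `R - i` rather than `R` makes the formula uniform in whether `i` already lies in
  -- `R`.
  sumOver-⊹ : ∀ (R : Subset n) i w → sumOver (R ⊹ i) w ≈ sumOver (R - i) w + w i
  sumOver-⊹ (b ∷ R) zero w rewrite ∪-identityʳ R = go b
    where
    go : ∀ b → (if b ∨ true then w zero else 0#) + sumOver R (w ∘ suc)
             ≈ 0# + sumOver (R ─ ⊥) (w ∘ suc) + w zero
    go true  = trans (+-comm _ _) (+-congʳ (trans (sym (sumOver-─⊥ R _)) (sym (+-identityˡ _))))
    -- Both values of `b` give the same goal, as `b ∨ true` computes to `true` and removal has
    -- already discarded `b` on the right.
    go false = go true
  sumOver-⊹ (inside  ∷ R) (suc i) w = trans (+-congˡ (sumOver-⊹ R i (w ∘ suc))) (sym (+-assoc _ _ _))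
  sumOver-⊹ (outside ∷ R) (suc i) w = trans (+-congˡ (sumOver-⊹ R i (w ∘ suc))) (sym (+-assoc _ _ _))

  -- Serves for a row `A j`, whose entry at `j` vanishes, to replace `S - j` by `S`.
  sumOver-remove : ∀ (R : Subset n) i w → w i ≈ 0# → sumOver (R - i) w ≈ sumOver R w
  sumOver-remove (inside  ∷ R) zero w wi≈0 = +-cong (sym wi≈0) (sumOver-─⊥ R _)
  sumOver-remove (outside ∷ R) zero w wi≈0 = +-congˡ (sumOver-─⊥ R _)
  sumOver-remove (inside  ∷ R) (suc i) w wi≈0 = +-congˡ (sumOver-remove R i (w ∘ suc) wi≈0)
  sumOver-remove (outside ∷ R) (suc i) w wi≈0 = +-congˡ (sumOver-remove R i (w ∘ suc) wi≈0)

  -- Marginals of the diversity function.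

  module _ {γ : Carrier} {A : Matrix n} (A-semiMetric : IsSemiMetric γ A) where

    open IsSemiMetric A-semiMetric

    -- The strictly upper triangular part of `A`; by definition `diversity A R` sums its entries
    -- over pairs from `R`.
    upper : Matrix n
    upper q q′ = if does (q <? q′) then A q q′ else 0#

    -- Exactly one of the two terms survives off the diagonal; on it both vanish, as does `A`.
    upper-symmetrized : ∀ i j → upper i j + upper j i ≈ A j i
    upper-symmetrized i j with <-cmp i j
    ... | tri< i<j _ j≮i rewrite dec-true (i <? j) i<j | dec-false (j <? i) j≮i =
      trans (+-identityʳ _) (symmetric i j)
    ... | tri> i≮j _ j<i rewrite dec-false (i <? j) i≮j | dec-true (j <? i) j<i = +-identityˡ _
    ... | tri≈ i≮i ≡.refl _ rewrite dec-false (i <? i) i≮i =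
      trans (+-identityʳ _) (sym (zeroDiagonal i))

    upper-diagonal : ∀ i → upper i i ≈ 0#
    upper-diagonal i rewrite dec-false (i <? i) (<ꟳ-irrefl ≡.refl) = refl

    -- Adding `j` to `S - j` adds column `j` and row `j` of `upper`, with a zero corner at
    -- `(j , j)`. Together they make up row `j` of `A`.
    diversity-⊹ : ∀ S j → diversity A (S ⊹ j) ≈ diversity A (S - j) + sumOver S (A j)
    diversity-⊹ S j = begin
      sumOver (S ⊹ j) (λ q → sumOver (S ⊹ j) (upper q))
        ≈⟨ sumOver-⊹ S j _ ⟩
      sumOver (S - j) (λ q → sumOver (S ⊹ j) (upper q)) + sumOver (S ⊹ j) (upper j)
        ≈⟨ +-cong (sumOver-cong (S - j) λ q → sumOver-⊹ S j (upper q)) row ⟩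
      sumOver (S - j) (λ q → sumOver (S - j) (upper q) + upper q j) + sumOver (S - j) (upper j)
        ≈⟨ +-congʳ (sumOver-+ (S - j) _ _) ⟩
      diversity A (S - j) + sumOver (S - j) (λ q → upper q j) + sumOver (S - j) (upper j)
        ≈⟨ +-assoc _ _ _ ⟩
      diversity A (S - j) + (sumOver (S - j) (λ q → upper q j) + sumOver (S - j) (upper j))
        ≈⟨ +-congˡ (sumOver-+ (S - j) _ _) ⟨
      diversity A (S - j) + sumOver (S - j) (λ q → upper q j + upper j q)
        ≈⟨ +-congˡ (sumOver-cong (S - j) λ q → upper-symmetrized q j) ⟩
      diversity A (S - j) + sumOver (S - j) (A j)
        ≈⟨ +-congˡ (sumOver-remove S j (A j) (zeroDiagonal j)) ⟩
      diversity A (S - j) + sumOver S (A j) ∎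
      where
      row : sumOver (S ⊹ j) (upper j) ≈ sumOver (S - j) (upper j)
      row = trans (sumOver-⊹ S j (upper j)) (trans (+-congˡ (upper-diagonal j)) (+-identityʳ _))

    sum-triangle : ∀ S i j →
      ∣ S ∣ × A i j ≤ γ * (sumOver S (A i) + sumOver S (A j))
    sum-triangle S i j = ≤-respˡ-≈ (sumOver-const S (A i j)) (≤-respʳ-≈ total
      (sumOver-mono S λ q → triangle i j q))
      where
      total : sumOver S (λ q → γ * (A i q + A q j)) ≈ γ * (sumOver S (A i) + sumOver S (A j))
      total = trans (sumOver-* S γ _) (*-congˡ (trans (sumOver-+ S _ _)
        (+-congˡ (sumOver-cong S λ q → symmetric q j))))

    -- Discrete derivatives and meta-submodularity.

    module _ (g : Fin n → Carrier) where

      f : SetFunction n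
      f R = diversity A R + modular g R

      B-explicit : ∀ j S → B f j S ≈ sumOver S (A j) + g j
      B-explicit j S = x≈y+z⇒x−y≈z
        (trans (+-cong (diversity-⊹ S j) (sumOver-⊹ S j g)) (interchange _ _ _ _))

      -- The marginal of `j` is a row sum plus the constant `g j`, so passing from `S - i` to
      -- `S ⊹ i` changes it only by the entry at `i`.
      secondDifference-explicit : ∀ i j S → secondDifference f i j S ≈ A j i
      secondDifference-explicit i j S = x≈y+z⇒x−y≈z (begin
        B f j (S ⊹ i)                       ≈⟨ B-explicit j (S ⊹ i) ⟩
        sumOver (S ⊹ i) (A j) + g j         ≈⟨ +-congʳ (sumOver-⊹ S i (A j)) ⟩
        sumOver (S - i) (A j) + A j i + g j ≈⟨ xy∙z≈xz∙y _ _ _ ⟩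
        sumOver (S - i) (A j) + g j + A j i ≈⟨ +-congʳ (B-explicit j (S - i)) ⟨
        B f j (S - i) + A j i               ∎)

      metaSubmodular : 1# ≤ γ → (∀ q → 0# ≤ g q) → MetaSubmodular γ f
      metaSubmodular 1≤γ 0≤g S S≢∅ i j = ≤-respˡ-≈ (sym (secondDifference-explicit i j S))
        -- Multiplying by `∣ S ∣` clears the division. The triangle bound is taken at `(j , i)` to
        -- match the entry `A j i`, and `1# ≤ γ` provides the `0# ≤ γ` that lets `γ` multiply
        -- `sums≤Bs`.
        (×-cancelˡ-≤ ∣ S ∣ (≤-respʳ-≈ clear (≤-trans (sum-triangle S j i)
          (*-monoˡ-≤-nonNeg (≤-trans (<⇒≤ 0<1) 1≤γ) sums≤Bs))))
        where
        instance
          ∣S∣≢0 : NonZero ∣ S ∣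
          ∣S∣≢0 = nonempty⇒nonZero S≢∅

        Bs = B f i S + B f j S

        clear : γ * Bs ≈ ∣ S ∣ × (γ * (Bs / ∣ S ∣))
        clear = trans (*-congˡ (sym (n×[x/n]≈x ∣ S ∣ Bs))) (×-comm-* ∣ S ∣ γ (Bs / ∣ S ∣))

        sums≤Bs : sumOver S (A j) + sumOver S (A i) ≤ Bs
        -- The row sums are swapped back into the order of `Bs`; each marginal exceeds its row sum
        -- by the non-negative weight `g i` or `g j`.
        sums≤Bs = ≤-respˡ-≈ (+-comm _ _) (≤-respʳ-≈ (sym (+-cong (B-explicit i S) (B-explicit j S)))
          (+-mono-≤ (x≤x+nonNeg (0≤g i)) (x≤x+nonNeg (0≤g j))))

proposition4 : ∀ {c ℓ₁ ℓ₂ ℓ₃} (F : OrderedField c ℓ₁ ℓ₂ ℓ₃) →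
    let open OrderedField F
        open SetFunctions F
    in (n : ℕ) (γ : Carrier) → 1# ≤ γ →
       (A : Matrix n) → IsSemiMetric γ A →
       (g : Fin n → Carrier) → (∀ q → 0# ≤ g q) →
       MetaSubmodular γ (λ R → diversity A R + modular g R)
proposition4 F n γ 1≤γ A A-semiMetric g 0≤g =
  SetFunctionProperties.metaSubmodular F A-semiMetric g 1≤γ 0≤g
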